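{- Minimizing $\mathrm{pfanout}_p$ in the limit as $p\to 1$ is equivalent to minimizing $\mathrm{fanout}$.
   Context: $G=(\mathcal{Q}\cup\mathcal{D},E)$ is an undirected bipartite graph with disjoint vertex sets $\mathcal{Q}$ (query vertices) and $\mathcal{D}$ (data vertices), where each edge joins a query vertex to a data vertex; put $n=|\mathcal{D}|$. An integer $k>1$ and a real number $\varepsilon\ge 0$ are given. A partitioning $P=\{V_1,\dots,V_k\}$ of $\mathcal{D}$ is a collection of $k$ disjoint subsets (buckets) covering $\mathcal{D}$; the buckets should be balanced, that is, $|V_i|\le(1+\varepsilon)\frac{n}{k}$ for all $1\le i\le k$. Minimization of an objective means finding such a partitioning for which the objective is smallest. For $q\in\mathcal{Q}$ and $1\le i\le k$, let $n_i(q)=|\{v: v\in V_i \text{ and } \{q,v\}\in E\}|$ be the number of data vertices in bucket $V_i$ adjacent to $q$. Fanout: the fanout of a query $q$ is the number of distinct buckets having a data vertex adjacent to $q$, $\mathrm{fanout}(P,q)=|\{V_i : \exists \{q,v\}\in E,\ v\in V_i\}|$, and $\mathrm{fanout}(P)=\frac{1}{|\mathcal{Q}|}\sum_{q\in\mathcal{Q}}\mathrm{fanout}(P,q)$. Probabilistic fanout, for $p\in(0,1)$: the probabilistic fanout of a query $q$ is $\sum_{i=1}^k\left(1-(1-p)^{n_i(q)}\right)$, and the objective is $$\mathrm{pfanout}_p(P)=\frac{1}{|\mathcal{Q}|}\sum_{q\in\mathcal{Q}}\sum_{i=1}^k\left(1-(1-p)^{n_i(q)}\right).$$ -}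

module Defs where

import Algebra.Properties.CommutativeSemigroup as CommutativeSemigroup
import Algebra.Properties.Group as Group
open import Algebra.Bundles using (AbelianGroup)
open import Data.Fin.Base using (Fin)
open import Data.Fin.Subset using (Subset; _∈_; _∩_; Empty)
  renaming (∣_∣ to card)
open import Data.Fin.Subset.Properties using (nonempty?)
open import Data.Integer.Base using (+_)
open import Data.Nat.Base as ℕ using (ℕ; zero; suc; NonZero; NonTrivial; nonTrivial⇒nonZero; _⊔_)
import Data.Nat.Properties as ℕ
open import Data.Product.Base using (∃-syntax; _×_; _,_; proj₁; proj₂)
open import Data.Rational.Base as ℚ using (ℚ; 0ℚ; 1ℚ; ½)
import Data.Rational.Properties as ℚ
open import Data.Sum.Base using (inj₁; inj₂)
open import Data.Vec.Base using (tabulate)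
import Data.Vec.Functional as Vector
open import Relation.Binary.PropositionalEquality
  using (_≡_; _≢_; sym; trans; cong; cong₂; subst)
open import Relation.Nullary.Decidable using (does)

------------------------------------------------------------------------
-- Real numbers

-- A real is a Cauchy sequence of rationals, given with a modulus. Two
-- sequences represent the same real when each is ≤ the other in the
-- order below; there is no quotient.

Cauchy : (ℕ → ℚ) → Set
Cauchy x = ∀ δ → 0ℚ ℚ.< δ →
  ∃[ N ] (∀ m n → N ℕ.≤ m → N ℕ.≤ n → ℚ.∣ x m ℚ.- x n ∣ ℚ.< δ)

record ℝ : Set where
  constructor mkℝ
  field
    seq    : ℕ → ℚ
    cauchy : Cauchy seq

open ℝ public

infix  4 _<_ _≤_ _⟶_
infixl 6 _+_ _-_
infixl 7 _*_
infix  8 -_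
infixr 8 _^_

_<_ : ℝ → ℝ → Set
x < y = ∃[ δ ] (0ℚ ℚ.< δ ×
  ∃[ N ] (∀ n → N ℕ.≤ n → seq x n ℚ.+ δ ℚ.≤ seq y n))

_≤_ : ℝ → ℝ → Set
x ≤ y = ∀ δ → 0ℚ ℚ.< δ →
  ∃[ N ] (∀ n → N ℕ.≤ n → seq x n ℚ.≤ seq y n ℚ.+ δ)

fromℚ : ℚ → ℝ
fromℚ q = mkℝ (λ _ → q) λ δ δ>0 → 0 , λ _ _ _ _ →
  subst (ℚ._< δ) (sym (cong ℚ.∣_∣ (ℚ.+-inverseʳ q))) δ>0

fromℕ : ℕ → ℝ
fromℕ n = fromℚ (+ n ℚ./ 1)

0ℝ 1ℝ : ℝ
0ℝ = fromℚ 0ℚ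
1ℝ = fromℚ 1ℚ

private
  open Group ℚ.+-0-group
    using (//-rightDividesˡ; //-rightDividesʳ; ⁻¹-anti-homo-//)
  open CommutativeSemigroup
    (AbelianGroup.commutativeSemigroup ℚ.+-0-abelianGroup) using (interchange)

  sum-of-differences : ∀ a b c d →
    (a ℚ.+ b) ℚ.- (c ℚ.+ d) ≡ (a ℚ.- c) ℚ.+ (b ℚ.- d)
  sum-of-differences a b c d =
    trans (cong (a ℚ.+ b ℚ.+_) (ℚ.neg-distrib-+ c d))
          (interchange a b (ℚ.- c) (ℚ.- d))

  telescope : ∀ a b c → (a ℚ.- b) ℚ.+ (b ℚ.- c) ≡ a ℚ.- c
  telescope a b c =
    trans (sym (ℚ.+-assoc (a ℚ.- b) b (ℚ.- c)))
          (cong (ℚ._- c) (//-rightDividesˡ b a))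

  *-distribˡ-- : ∀ a b c → a ℚ.* (b ℚ.- c) ≡ a ℚ.* b ℚ.- a ℚ.* c
  *-distribˡ-- a b c =
    trans (ℚ.*-distribˡ-+ a b (ℚ.- c))
          (cong (a ℚ.* b ℚ.+_) (sym (ℚ.neg-distribʳ-* a c)))

  difference-of-products : ∀ a b c d →
    a ℚ.* b ℚ.- c ℚ.* d ≡ a ℚ.* (b ℚ.- d) ℚ.+ d ℚ.* (a ℚ.- c)
  difference-of-products a b c d = sym (trans
    (cong₂ ℚ._+_ (*-distribˡ-- a b d)
      (trans (*-distribˡ-- d a c)
        (cong₂ ℚ._-_ (ℚ.*-comm d a) (ℚ.*-comm d c))))
    (telescope (a ℚ.* b) (a ℚ.* d) (c ℚ.* d)))

  half : ∀ {δ} → 0ℚ ℚ.< δ → 0ℚ ℚ.< ½ ℚ.* δ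
  half δ>0 = ℚ.*-monoʳ-<-pos ½ δ>0

  half+half : ∀ δ → ½ ℚ.* δ ℚ.+ ½ ℚ.* δ ≡ δ
  half+half δ = trans (sym (ℚ.*-distribʳ-+ δ ½ ½)) (ℚ.*-identityˡ δ)

  +-cauchy : ∀ {x y} → Cauchy x → Cauchy y → Cauchy (λ n → x n ℚ.+ y n)
  +-cauchy {x} {y} cx cy δ δ>0 with cx _ (half δ>0) | cy _ (half δ>0)
  ... | M , hx | N , hy = M ⊔ N , λ m n m≥ n≥ → begin-strict
    ℚ.∣ (x m ℚ.+ y m) ℚ.- (x n ℚ.+ y n) ∣
      ≡⟨ cong ℚ.∣_∣ (sum-of-differences (x m) (y m) (x n) (y n)) ⟩
    ℚ.∣ (x m ℚ.- x n) ℚ.+ (y m ℚ.- y n) ∣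
      ≤⟨ ℚ.∣p+q∣≤∣p∣+∣q∣ (x m ℚ.- x n) (y m ℚ.- y n) ⟩
    ℚ.∣ x m ℚ.- x n ∣ ℚ.+ ℚ.∣ y m ℚ.- y n ∣
      <⟨ ℚ.+-mono-< (hx m n (ℕ.m⊔n≤o⇒m≤o M N m≥) (ℕ.m⊔n≤o⇒m≤o M N n≥))
                    (hy m n (ℕ.m⊔n≤o⇒n≤o M N m≥) (ℕ.m⊔n≤o⇒n≤o M N n≥)) ⟩
    ½ ℚ.* δ ℚ.+ ½ ℚ.* δ
      ≡⟨ half+half δ ⟩
    δ ∎
    where open ℚ.≤-Reasoning

  neg-cauchy : ∀ {x} → Cauchy x → Cauchy (λ n → ℚ.- x n)
  neg-cauchy {x} cx δ δ>0 with cx δ δ>0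
  ... | N , h = N , λ m n m≥ n≥ → subst (ℚ._< δ)
    (trans (sym (ℚ.∣-p∣≡∣p∣ (x m ℚ.- x n)))
           (cong ℚ.∣_∣ (ℚ.neg-distrib-+ (x m) (ℚ.- x n))))
    (h m n m≥ n≥)

  ∣a∣≤∣a-b∣+∣b∣ : ∀ a b → ℚ.∣ a ∣ ℚ.≤ ℚ.∣ a ℚ.- b ∣ ℚ.+ ℚ.∣ b ∣
  ∣a∣≤∣a-b∣+∣b∣ a b = subst (λ t → ℚ.∣ t ∣ ℚ.≤ ℚ.∣ a ℚ.- b ∣ ℚ.+ ℚ.∣ b ∣)
    (//-rightDividesˡ b a)
    (ℚ.∣p+q∣≤∣p∣+∣q∣ (a ℚ.- b) b)

  ∣a∣-∣b∣≤∣a-b∣ : ∀ a b → ℚ.∣ a ∣ ℚ.- ℚ.∣ b ∣ ℚ.≤ ℚ.∣ a ℚ.- b ∣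
  ∣a∣-∣b∣≤∣a-b∣ a b = subst (ℚ.∣ a ∣ ℚ.- ℚ.∣ b ∣ ℚ.≤_)
    (//-rightDividesʳ ℚ.∣ b ∣ ℚ.∣ a ℚ.- b ∣)
    (ℚ.+-monoˡ-≤ (ℚ.- ℚ.∣ b ∣) (∣a∣≤∣a-b∣+∣b∣ a b))

  ∣a-b∣≡∣b-a∣ : ∀ a b → ℚ.∣ a ℚ.- b ∣ ≡ ℚ.∣ b ℚ.- a ∣
  ∣a-b∣≡∣b-a∣ a b = trans (sym (ℚ.∣-p∣≡∣p∣ (a ℚ.- b)))
    (cong ℚ.∣_∣ (⁻¹-anti-homo-// a b))

  ∣∣a∣-∣b∣∣≤∣a-b∣ : ∀ a b → ℚ.∣ ℚ.∣ a ∣ ℚ.- ℚ.∣ b ∣ ∣ ℚ.≤ ℚ.∣ a ℚ.- b ∣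
  ∣∣a∣-∣b∣∣≤∣a-b∣ a b with ℚ.∣p∣≡p∨∣p∣≡-p (ℚ.∣ a ∣ ℚ.- ℚ.∣ b ∣)
  ... | inj₁ e = subst (ℚ._≤ ℚ.∣ a ℚ.- b ∣) (sym e) (∣a∣-∣b∣≤∣a-b∣ a b)
  ... | inj₂ e = subst (ℚ._≤ ℚ.∣ a ℚ.- b ∣)
    (sym (trans e (⁻¹-anti-homo-// ℚ.∣ a ∣ ℚ.∣ b ∣)))
    (subst (ℚ.∣ b ∣ ℚ.- ℚ.∣ a ∣ ℚ.≤_) (∣a-b∣≡∣b-a∣ b a) (∣a∣-∣b∣≤∣a-b∣ b a))

  abs-cauchy : ∀ {x} → Cauchy x → Cauchy (λ n → ℚ.∣ x n ∣)
  abs-cauchy {x} cx δ δ>0 with cx δ δ>0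
  ... | N , h = N , λ m n m≥ n≥ →
    ℚ.≤-<-trans (∣∣a∣-∣b∣∣≤∣a-b∣ (x m) (x n)) (h m n m≥ n≥)

  bounded : ∀ {x} → Cauchy x →
    ∃[ B ] (0ℚ ℚ.< B × ∃[ N ] (∀ n → N ℕ.≤ n → ℚ.∣ x n ∣ ℚ.≤ B))
  bounded {x} cx with cx 1ℚ (ℚ.positive⁻¹ 1ℚ)
  ... | N , h = 1ℚ ℚ.+ ℚ.∣ x N ∣
    , ℚ.+-mono-<-≤ (ℚ.positive⁻¹ 1ℚ) (ℚ.0≤∣p∣ (x N))
    , N , λ n n≥ → ℚ.≤-trans (∣a∣≤∣a-b∣+∣b∣ (x n) (x N))
        (ℚ.+-monoˡ-≤ ℚ.∣ x N ∣ (ℚ.<⇒≤ (h n N n≥ ℕ.≤-refl)))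

  quotient : ∀ {B δ} → 0ℚ ℚ.< B → 0ℚ ℚ.< δ →
    ∃[ e ] (0ℚ ℚ.< e × B ℚ.* e ≡ δ)
  quotient {B} {δ} B>0 δ>0 = (ℚ.1/ B) ℚ.* δ
    , ℚ.positive⁻¹ _ {{ℚ.pos*pos⇒pos (ℚ.1/ B) {{ℚ.1/pos⇒pos B}} δ}}
    , trans (sym (ℚ.*-assoc B (ℚ.1/ B) δ))
        (trans (cong (ℚ._* δ) (ℚ.*-inverseʳ B)) (ℚ.*-identityˡ δ))
    where
    instance
      B⁺ : ℚ.Positive B
      B⁺ = ℚ.positive B>0
      δ⁺ : ℚ.Positive δ
      δ⁺ = ℚ.positive δ>0
      B≢0 : ℚ.NonZero B
      B≢0 = ℚ.pos⇒nonZero B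

  ∣a∣∣b∣<Be : ∀ {a b B e} → 0ℚ ℚ.< B → ℚ.∣ a ∣ ℚ.≤ B → ℚ.∣ b ∣ ℚ.< e →
    ℚ.∣ a ℚ.* b ∣ ℚ.< B ℚ.* e
  ∣a∣∣b∣<Be {a} {b} {B} {e} B>0 a≤B b<e = begin-strict
    ℚ.∣ a ℚ.* b ∣         ≡⟨ ℚ.∣p*q∣≡∣p∣*∣q∣ a b ⟩
    ℚ.∣ a ∣ ℚ.* ℚ.∣ b ∣   ≤⟨ ℚ.*-monoʳ-≤-nonNeg ℚ.∣ b ∣ {{ℚ.nonNegative (ℚ.0≤∣p∣ b)}} a≤B ⟩
    B ℚ.* ℚ.∣ b ∣         <⟨ ℚ.*-monoʳ-<-pos B {{ℚ.positive B>0}} b<e ⟩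
    B ℚ.* e               ∎
    where open ℚ.≤-Reasoning

  *-cauchy : ∀ {x y} → Cauchy x → Cauchy y → Cauchy (λ n → x n ℚ.* y n)
  *-cauchy {x} {y} cx cy δ δ>0 with bounded cx | bounded cy
  ... | A , A>0 , K , hA | B , B>0 , L , hB
    with quotient A>0 (half δ>0) | quotient B>0 (half δ>0)
  ... | d , d>0 , Ad≡ | e , e>0 , Be≡ with cx e e>0 | cy d d>0
  ... | M , hx | N , hy = (K ⊔ L) ⊔ (M ⊔ N) , λ m n m≥ n≥ → begin-strict
    ℚ.∣ x m ℚ.* y m ℚ.- x n ℚ.* y n ∣
      ≡⟨ cong ℚ.∣_∣ (difference-of-products (x m) (y m) (x n) (y n)) ⟩
    ℚ.∣ x m ℚ.* (y m ℚ.- y n) ℚ.+ y n ℚ.* (x m ℚ.- x n) ∣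
      ≤⟨ ℚ.∣p+q∣≤∣p∣+∣q∣ (x m ℚ.* (y m ℚ.- y n)) (y n ℚ.* (x m ℚ.- x n)) ⟩
    ℚ.∣ x m ℚ.* (y m ℚ.- y n) ∣ ℚ.+ ℚ.∣ y n ℚ.* (x m ℚ.- x n) ∣
      <⟨ ℚ.+-mono-<
           (∣a∣∣b∣<Be {x m} A>0 (hA m (toK m≥)) (hy m n (toN m≥) (toN n≥)))
           (∣a∣∣b∣<Be {y n} B>0 (hB n (toL n≥)) (hx m n (toM m≥) (toM n≥))) ⟩
    A ℚ.* d ℚ.+ B ℚ.* e
      ≡⟨ cong₂ ℚ._+_ Ad≡ Be≡ ⟩
    ½ ℚ.* δ ℚ.+ ½ ℚ.* δ
      ≡⟨ half+half δ ⟩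
    δ ∎
    where
    open ℚ.≤-Reasoning
    toK : ∀ {j} → (K ⊔ L) ⊔ (M ⊔ N) ℕ.≤ j → K ℕ.≤ j
    toK h = ℕ.m⊔n≤o⇒m≤o K L (ℕ.m⊔n≤o⇒m≤o (K ⊔ L) (M ⊔ N) h)
    toL : ∀ {j} → (K ⊔ L) ⊔ (M ⊔ N) ℕ.≤ j → L ℕ.≤ j
    toL h = ℕ.m⊔n≤o⇒n≤o K L (ℕ.m⊔n≤o⇒m≤o (K ⊔ L) (M ⊔ N) h)
    toM : ∀ {j} → (K ⊔ L) ⊔ (M ⊔ N) ℕ.≤ j → M ℕ.≤ j
    toM h = ℕ.m⊔n≤o⇒m≤o M N (ℕ.m⊔n≤o⇒n≤o (K ⊔ L) (M ⊔ N) h)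
    toN : ∀ {j} → (K ⊔ L) ⊔ (M ⊔ N) ℕ.≤ j → N ℕ.≤ j
    toN h = ℕ.m⊔n≤o⇒n≤o M N (ℕ.m⊔n≤o⇒n≤o (K ⊔ L) (M ⊔ N) h)

_+_ : ℝ → ℝ → ℝ
x + y = mkℝ (λ n → seq x n ℚ.+ seq y n) (+-cauchy {seq x} {seq y} (cauchy x) (cauchy y))

-_ : ℝ → ℝ
- x = mkℝ (λ n → ℚ.- seq x n) (neg-cauchy {seq x} (cauchy x))

_-_ : ℝ → ℝ → ℝ
x - y = x + (- y)

_*_ : ℝ → ℝ → ℝ
x * y = mkℝ (λ n → seq x n ℚ.* seq y n) (*-cauchy {seq x} {seq y} (cauchy x) (cauchy y))

∣_∣ : ℝ → ℝ
∣ x ∣ = mkℝ (λ n → ℚ.∣ seq x n ∣) (abs-cauchy {seq x} (cauchy x))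

_^_ : ℝ → ℕ → ℝ
x ^ zero  = 1ℝ
x ^ suc n = x * x ^ n

∑ : ∀ {n} → (Fin n → ℝ) → ℝ
∑ = Vector.foldr _+_ 0ℝ

-- A holds for all p ∈ (0,1) sufficiently close to 1.
Near1 : (ℝ → Set) → Set
Near1 A = ∃[ δ ] (0ℝ < δ × (∀ p → 0ℝ < p → p < 1ℝ → 1ℝ - p < δ → A p))

-- f p tends to ℓ as p → 1 within (0,1).
_⟶_ : (ℝ → ℝ) → ℝ → Set
f ⟶ ℓ = ∀ e → 0ℝ < e → Near1 (λ p → ∣ f p - ℓ ∣ < e)

------------------------------------------------------------------------
-- Partitionings of the data vertices of a bipartite graph

-- m query vertices and n data vertices; the graph is given by the
-- neighbourhood of each query vertex.
BipartiteGraph : ℕ → ℕ → Set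
BipartiteGraph m n = Fin m → Subset n

-- Buckets may be empty.
record Partitioning (n k : ℕ) : Set where
  field
    bucket   : Fin k → Subset n
    disjoint : ∀ i j → i ≢ j → Empty (bucket i ∩ bucket j)
    covers   : ∀ v → ∃[ i ] v ∈ bucket i

open Partitioning public

Balanced : ∀ {n k} .{{_ : NonTrivial k}} → ℝ → Partitioning n k → Set
Balanced {n} {k} ε P =
  ∀ i → fromℕ (card (bucket P i)) ≤ (1ℝ + ε) * fromℚ (+ n ℚ./ k)
  where
  instance
    k≢0 : NonZero k
    k≢0 = nonTrivial⇒nonZero k

Minimizes : ∀ {n k} .{{_ : NonTrivial k}} → ℝ →
  (Partitioning n k → ℝ) → Partitioning n k → Set
Minimizes ε f P = Balanced ε P × (∀ P′ → Balanced ε P′ → f P ≤ f P′)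

average : ∀ {m} .{{_ : NonZero m}} → (Fin m → ℝ) → ℝ
average {m} f = fromℚ (+ 1 ℚ./ m) * ∑ f

module _ {m n k : ℕ} (G : BipartiteGraph m n) where

  neighboursIn : Partitioning n k → Fin k → Fin m → ℕ
  neighboursIn P i q = card (G q ∩ bucket P i)

  -- Counting indices counts distinct buckets: a bucket meeting G q is
  -- nonempty, and disjointness keeps nonempty buckets distinct.
  queryFanout : Partitioning n k → Fin m → ℕ
  queryFanout P q = card (tabulate λ i → does (nonempty? (G q ∩ bucket P i)))

  queryPFanout : ℝ → Partitioning n k → Fin m → ℝ
  queryPFanout p P q = ∑ λ i → 1ℝ - (1ℝ - p) ^ neighboursIn P i q

  fanout : .{{_ : NonZero m}} → Partitioning n k → ℝ
  fanout P = average λ q → fromℕ (queryFanout P q)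

  pfanout : .{{_ : NonZero m}} → ℝ → Partitioning n k → ℝ
  pfanout p P = average λ q → queryPFanout p P q

{-# OPTIONS --safe #-}
-- With r = 1 − p ∈ [0,1], a bucket containing c neighbours of a query
-- contributes 1 − r ^ c to the probabilistic fanout, against 1 (if c > 0)
-- or 0 (if c = 0) to the fanout; the excess of the latter lies in [0 , r].
-- So pfanout tends to fanout from below, uniformly in the partitioning.
-- Fanouts are multiples of 1/m, so once the error is well below 1/m a
-- minimizer of pfanout cannot be beaten in fanout.
module Submission where

import Algebra.Properties.Semiring.Sum as SemiringSum
open import Algebra.Bundles using (CommutativeRing)
open import Data.Bool.Base using (Bool; true; false; if_then_else_)
open import Data.Empty using (⊥; ⊥-elim)
open import Data.Fin.Base using (Fin; zero; suc)
open import Data.Fin.Subset using (Subset; Nonempty; _∈_; _∩_)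
  renaming (∣_∣ to card)
open import Data.Fin.Subset.Properties
  using (nonempty?; Empty-unique; ∣⊥∣≡0; p⊆q⇒∣p∣≤∣q∣; x∈⁅y⁆⇒x≡y; ∣⁅x⁆∣≡1)
open import Data.Integer.Base as ℤ using (+_)
import Data.Integer.Properties as ℤ
open import Data.Nat.Base as ℕ using (ℕ; zero; suc; NonZero; NonTrivial; _⊔_)
import Data.Nat.Properties as ℕ
open import Data.Product.Base using (∃-syntax; _×_; _,_; proj₁; proj₂)
open import Data.Rational.Base as ℚ using (ℚ; 0ℚ; 1ℚ; ½)
import Data.Rational.Properties as ℚ
import Data.Rational.Solver as ℚSolver
open import Data.Rational.Unnormalised.Base as ℚᵘ using (mkℚᵘ; *≡*)
import Data.Rational.Unnormalised.Properties as ℚᵘ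
open import Data.Sum.Base as Sum using (_⊎_; inj₁; inj₂)
open import Data.Vec.Base using (tabulate)
open import Function.Base using (_∘_)
open import Function.Bundles using (_⇔_; mk⇔)
open import Relation.Binary.PropositionalEquality
  using (_≡_; refl; sym; trans; cong; cong₂; subst; subst₂)
open import Relation.Nullary using (yes; no)
open import Relation.Nullary.Decidable using (does; from-yes)
open import Defs

open SemiringSum (CommutativeRing.semiring ℚ.+-*-commutativeRing)
  using (sum; ∑-distrib-+; *-distribʳ-sum)
open SemiringSum ℕ.+-*-semiring using () renaming (sum to sumℕ)
open ℚSolver.+-*-Solver using (solve; _:=_; _:+_; _:-_; _:*_; :-_; con)

-- Rational arithmetic

x≤x+y : ∀ x {y} → 0ℚ ℚ.≤ y → x ℚ.≤ x ℚ.+ y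
x≤x+y x 0≤y = subst (ℚ._≤ x ℚ.+ _) (ℚ.+-identityʳ x) (ℚ.+-monoʳ-≤ x 0≤y)

x-y≤x : ∀ x {y} → 0ℚ ℚ.≤ y → x ℚ.- y ℚ.≤ x
x-y≤x x 0≤y = subst (x ℚ.- _ ℚ.≤_) (ℚ.+-identityʳ x) (ℚ.+-monoʳ-≤ x (ℚ.neg-antimono-≤ 0≤y))

x-y+y≡x : ∀ x y → x ℚ.- y ℚ.+ y ≡ x
x-y+y≡x = solve 2 (λ x y → x :- y :+ y := x) refl

x≤y+z⇒x-y≤z : ∀ {x y z} → x ℚ.≤ y ℚ.+ z → x ℚ.- y ℚ.≤ z
x≤y+z⇒x-y≤z {x} {y} {z} h = subst (x ℚ.- y ℚ.≤_)
  (solve 2 (λ y z → y :+ z :- y := z) refl y z) (ℚ.+-monoˡ-≤ (ℚ.- y) h)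

x-y≤z⇒x≤y+z : ∀ {x y z} → x ℚ.- y ℚ.≤ z → x ℚ.≤ y ℚ.+ z
x-y≤z⇒x≤y+z {x} {y} {z} h = subst₂ ℚ._≤_
  (x-y+y≡x x y) (ℚ.+-comm z y) (ℚ.+-monoˡ-≤ y h)

x≤y⇒0≤y-x : ∀ {x y} → x ℚ.≤ y → 0ℚ ℚ.≤ y ℚ.- x
x≤y⇒0≤y-x {x} {y} h = subst (ℚ._≤ y ℚ.- x) (ℚ.+-inverseʳ x) (ℚ.+-monoˡ-≤ (ℚ.- x) h)

x+y≤z⇒x≤z : ∀ {x y z} → 0ℚ ℚ.< y → x ℚ.+ y ℚ.≤ z → x ℚ.≤ z
x+y≤z⇒x≤z {x} 0<y = ℚ.≤-trans (x≤x+y x (ℚ.<⇒≤ 0<y))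

x≤∣x∣ : ∀ x → x ℚ.≤ ℚ.∣ x ∣
x≤∣x∣ x with ℚ.≤-total 0ℚ x
... | inj₁ 0≤x = ℚ.≤-reflexive (sym (ℚ.0≤p⇒∣p∣≡p 0≤x))
... | inj₂ x≤0 = ℚ.≤-trans x≤0 (ℚ.0≤∣p∣ x)

∣x-y∣≡∣y-x∣ : ∀ x y → ℚ.∣ x ℚ.- y ∣ ≡ ℚ.∣ y ℚ.- x ∣
∣x-y∣≡∣y-x∣ x y = trans (sym (ℚ.∣-p∣≡∣p∣ (x ℚ.- y)))
  (cong ℚ.∣_∣ (solve 2 (λ x y → :- (x :- y) := y :- x) refl x y))

∣x-y∣≤z⇒x≤y+z : ∀ {x y z} → ℚ.∣ x ℚ.- y ∣ ℚ.≤ z → x ℚ.≤ y ℚ.+ z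
∣x-y∣≤z⇒x≤y+z {x} {y} h = x-y≤z⇒x≤y+z (ℚ.≤-trans (x≤∣x∣ (x ℚ.- y)) h)

x≤y≤x+z⇒∣x-y∣≤z : ∀ {x y z} → x ℚ.≤ y → y ℚ.≤ x ℚ.+ z → ℚ.∣ x ℚ.- y ∣ ℚ.≤ z
x≤y≤x+z⇒∣x-y∣≤z {x} {y} {z} x≤y y≤x+z = subst (ℚ._≤ z)
  (sym (trans (∣x-y∣≡∣y-x∣ x y) (ℚ.0≤p⇒∣p∣≡p (x≤y⇒0≤y-x x≤y))))
  (x≤y+z⇒x-y≤z y≤x+z)

0<½x : ∀ {x} → 0ℚ ℚ.< x → 0ℚ ℚ.< ½ ℚ.* x
0<½x = ℚ.*-monoʳ-<-pos ½

x+½y+½y≡x+y : ∀ x y → x ℚ.+ ½ ℚ.* y ℚ.+ ½ ℚ.* y ≡ x ℚ.+ y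
x+½y+½y≡x+y = solve 2 (λ x y → x :+ con ½ :* y :+ con ½ :* y := x :+ y) refl

-- Triangle inequality through `z`: in the uniqueness of limits, `z` is a value of the function that
-- lies near both candidate limits.
midpoint-≤ : ∀ x y z e → ℚ.∣ z ℚ.- x ∣ ℚ.≤ ½ ℚ.* e → ℚ.∣ z ℚ.- y ∣ ℚ.≤ ½ ℚ.* e →
  x ℚ.≤ y ℚ.+ e
midpoint-≤ x y z e zx zy = begin
  x                              ≤⟨ ∣x-y∣≤z⇒x≤y+z {x} {z} (subst (ℚ._≤ ½ ℚ.* e) (∣x-y∣≡∣y-x∣ z x) zx) ⟩
  z ℚ.+ ½ ℚ.* e                  ≤⟨ ℚ.+-monoˡ-≤ (½ ℚ.* e) (∣x-y∣≤z⇒x≤y+z {z} {y} zy) ⟩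
  y ℚ.+ ½ ℚ.* e ℚ.+ ½ ℚ.* e      ≡⟨ x+½y+½y≡x+y y e ⟩
  y ℚ.+ e                        ∎
  where open ℚ.≤-Reasoning

½x<x : ∀ {x} → 0ℚ ℚ.< x → ½ ℚ.* x ℚ.< x
½x<x {x} x>0 = subst (½ ℚ.* x ℚ.<_) (ℚ.*-identityˡ x)
  (ℚ.*-monoˡ-<-pos x {{ℚ.positive x>0}} (from-yes (½ ℚ.<? 1ℚ)))

-- Here `v`, `v′` stand for fanouts, `w`, `w′` for the matching pfanouts, and `u` for `1/m`.
-- Chaining the last three bounds gives `v` at most `v′` plus half of `u`, against a gap of `u`.
gap-too-wide : ∀ {u v v′ w w′} → 0ℚ ℚ.< u →
  u ℚ.+ v′ ℚ.≤ v → v ℚ.≤ w ℚ.+ ½ ℚ.* (½ ℚ.* u) →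
  w ℚ.≤ w′ ℚ.+ ½ ℚ.* (½ ℚ.* u) → w′ ℚ.≤ v′ → ⊥
gap-too-wide {u} {v} {v′} {w} {w′} u>0 gap v≤ w≤ w′≤v′ = ℚ.<-irrefl refl (begin-strict
  v                                                   ≤⟨ v≤ ⟩
  w ℚ.+ ½ ℚ.* (½ ℚ.* u)                               ≤⟨ ℚ.+-monoˡ-≤ (½ ℚ.* (½ ℚ.* u)) w≤ ⟩
  w′ ℚ.+ ½ ℚ.* (½ ℚ.* u) ℚ.+ ½ ℚ.* (½ ℚ.* u)          ≡⟨ x+½y+½y≡x+y w′ (½ ℚ.* u) ⟩
  w′ ℚ.+ ½ ℚ.* u                                      ≤⟨ ℚ.+-monoˡ-≤ (½ ℚ.* u) w′≤v′ ⟩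
  v′ ℚ.+ ½ ℚ.* u                                      <⟨ ℚ.+-monoʳ-< v′ (½x<x u>0) ⟩
  v′ ℚ.+ u                                            ≡⟨ ℚ.+-comm v′ u ⟩
  u ℚ.+ v′                                            ≤⟨ gap ⟩
  v                                                   ∎)
  where open ℚ.≤-Reasoning

½≤1-x : ∀ {x} → x ℚ.≤ ½ → 0ℚ ℚ.+ ½ ℚ.≤ 1ℚ ℚ.- x
½≤1-x {x} x≤½ = ℚ.≤-trans {j = 1ℚ ℚ.- ½} (ℚ.≤-reflexive refl)
  (ℚ.+-monoʳ-≤ 1ℚ (ℚ.neg-antimono-≤ x≤½))

1-[1-½x]+½x≡x : ∀ x → 1ℚ ℚ.- (1ℚ ℚ.- ½ ℚ.* x) ℚ.+ ½ ℚ.* x ≡ x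
1-[1-½x]+½x≡x = solve 1 (λ x →
  con 1ℚ :- (con 1ℚ :- con ½ :* x) :+ con ½ :* x := x) refl

½x+½x≡0+x : ∀ x → ½ ℚ.* x ℚ.+ ½ ℚ.* x ≡ 0ℚ ℚ.+ x
½x+½x≡0+x = solve 1 (λ x → con ½ :* x :+ con ½ :* x := con 0ℚ :+ x) refl

x+x*y≡x*[1+y] : ∀ x y → x ℚ.+ x ℚ.* y ≡ x ℚ.* (1ℚ ℚ.+ y)
x+x*y≡x*[1+y] = solve 2 (λ x y → x :+ x :* y := x :* (con 1ℚ :+ y)) refl

x*y+y≡[1+x]*y : ∀ x y → x ℚ.* y ℚ.+ y ≡ (1ℚ ℚ.+ x) ℚ.* y
x*y+y≡[1+x]*y = solve 2 (λ x y → x :* y :+ y := (con 1ℚ :+ x) :* y) refl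

w*[x+y*z]≡w*x+w*y*z : ∀ w x y z →
  w ℚ.* (x ℚ.+ y ℚ.* z) ≡ w ℚ.* x ℚ.+ w ℚ.* y ℚ.* z
w*[x+y*z]≡w*x+w*y*z = solve 4 (λ w x y z →
  w :* (x :+ y :* z) := w :* x :+ w :* y :* z) refl

-- Finite sums

sum-mono-≤ : ∀ {n} {x y : Fin n → ℚ} → (∀ i → x i ℚ.≤ y i) → sum x ℚ.≤ sum y
sum-mono-≤ {zero}  h = ℚ.≤-refl
sum-mono-≤ {suc n} h = ℚ.+-mono-≤ (h zero) (sum-mono-≤ (h ∘ suc))

0≤sum : ∀ {n} {x : Fin n → ℚ} → (∀ i → 0ℚ ℚ.≤ x i) → 0ℚ ℚ.≤ sum x
0≤sum {zero}  h = ℚ.≤-refl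
0≤sum {suc n} h = ℚ.+-mono-≤ (h zero) (0≤sum (h ∘ suc))

-- The conclusion has the shape of the hypothesis, with weight `sum e` and the same `r`, so the
-- bound can be iterated: first over buckets, then over queries.
sum-mono-≤-error : ∀ {n} {x y e : Fin n → ℚ} {r} →
  (∀ i → x i ℚ.≤ y i ℚ.+ e i ℚ.* r) → sum x ℚ.≤ sum y ℚ.+ sum e ℚ.* r
sum-mono-≤-error {x = x} {y} {e} {r} h = subst (sum x ℚ.≤_)
  (trans (∑-distrib-+ y (λ i → e i ℚ.* r))
         (cong (sum y ℚ.+_) (sym (*-distribʳ-sum r e))))
  (sum-mono-≤ h)

seq-∑ : ∀ {n} (f : Fin n → ℝ) j → seq (∑ f) j ≡ sum (λ i → seq (f i) j)
seq-∑ {zero}  f j = refl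
seq-∑ {suc n} f j = cong (seq (f zero) j ℚ.+_) (seq-∑ (f ∘ suc) j)

-- Counts as rational numbers

ι : ℕ → ℚ
ι n = + n ℚ./ 1

-- `ι` normalises its fraction and does not compute on variables. For unnormalised rationals of
-- denominator 1 the identity is one of integers.
ι-+ : ∀ a b → ι (a ℕ.+ b) ≡ ι a ℚ.+ ι b
ι-+ a b = ℚ.toℚᵘ-injective (begin
  ℚ.toℚᵘ (ι (a ℕ.+ b))                  ≈⟨ ℚ.toℚᵘ-fromℚᵘ (mkℚᵘ (+ (a ℕ.+ b)) 0) ⟩
  mkℚᵘ (+ (a ℕ.+ b)) 0                  ≈⟨ *≡* (cong (ℤ._* + 1) (sym (cong₂ ℤ._+_ (ℤ.*-identityʳ (+ a)) (ℤ.*-identityʳ (+ b))))) ⟩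
  mkℚᵘ (+ a) 0 ℚᵘ.+ mkℚᵘ (+ b) 0        ≈⟨ ℚᵘ.+-cong (ℚ.toℚᵘ-fromℚᵘ (mkℚᵘ (+ a) 0)) (ℚ.toℚᵘ-fromℚᵘ (mkℚᵘ (+ b) 0)) ⟨
  ℚ.toℚᵘ (ι a) ℚᵘ.+ ℚ.toℚᵘ (ι b)        ≈⟨ ℚ.toℚᵘ-homo-+ (ι a) (ι b) ⟨
  ℚ.toℚᵘ (ι a ℚ.+ ι b)                  ∎)
  where open ℚᵘ.≃-Reasoning

0≤ι : ∀ a → 0ℚ ℚ.≤ ι a
0≤ι a = ℚ.nonNegative⁻¹ (ι a) {{ℚ.normalize-nonNeg a 1}}

ι-mono-≤ : ∀ {a b} → a ℕ.≤ b → ι a ℚ.≤ ι b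
ι-mono-≤ {a} {b} a≤b = subst (ι a ℚ.≤_)
  (trans (sym (ι-+ a (b ℕ.∸ a))) (cong ι (ℕ.m+[n∸m]≡n a≤b)))
  (x≤x+y (ι a) (0≤ι (b ℕ.∸ a)))

ι-sum : ∀ {n} (f : Fin n → ℕ) → ι (sumℕ f) ≡ sum (ι ∘ f)
ι-sum {zero}  f = refl
ι-sum {suc n} f = trans (ι-+ (f zero) (sumℕ (f ∘ suc)))
  (cong (ι (f zero) ℚ.+_) (ι-sum (f ∘ suc)))

indicator : Bool → ℚ
indicator b = if b then 1ℚ else 0ℚ

ι-card-tabulate : ∀ {n} (b : Fin n → Bool) →
  ι (card (tabulate b)) ≡ sum (indicator ∘ b)
ι-card-tabulate {zero}  b = refl
ι-card-tabulate {suc n} b with b zero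
... | true  = trans (ι-+ 1 (card (tabulate (b ∘ suc))))
                    (cong (1ℚ ℚ.+_) (ι-card-tabulate (b ∘ suc)))
... | false = trans (ι-card-tabulate (b ∘ suc)) (sym (ℚ.+-identityˡ _))

nonempty⇒1≤card : ∀ {n} {s : Subset n} → Nonempty s → 1 ℕ.≤ card s
nonempty⇒1≤card {s = s} (x , x∈s) = subst (ℕ._≤ card s) (∣⁅x⁆∣≡1 x)
  (p⊆q⇒∣p∣≤∣q∣ λ y∈⁅x⁆ → subst (λ z → z ∈ s) (sym (x∈⁅y⁆⇒x≡y x y∈⁅x⁆)) x∈s)

-- Limits of reals

≤-trans : ∀ {x y z} → x ≤ y → y ≤ z → x ≤ z
≤-trans {x} {y} {z} x≤y y≤z δ δ>0 with x≤y _ (0<½x δ>0) | y≤z _ (0<½x δ>0)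
... | M , hx | N , hy = M ⊔ N , λ n n≥ → begin
  seq x n                                   ≤⟨ hx n (ℕ.m⊔n≤o⇒m≤o M N n≥) ⟩
  seq y n ℚ.+ ½ ℚ.* δ                       ≤⟨ ℚ.+-monoˡ-≤ (½ ℚ.* δ) (hy n (ℕ.m⊔n≤o⇒n≤o M N n≥)) ⟩
  seq z n ℚ.+ ½ ℚ.* δ ℚ.+ ½ ℚ.* δ           ≡⟨ x+½y+½y≡x+y (seq z n) δ ⟩
  seq z n ℚ.+ δ                             ∎
  where open ℚ.≤-Reasoning

0<fromℚ : ∀ {d} → 0ℚ ℚ.< d → 0ℝ < fromℚ d
0<fromℚ {d} d>0 = d , d>0 , 0 , λ _ _ → ℚ.≤-reflexive (ℚ.+-identityˡ d)

-- The existential premise is what remains of `0ℝ < y` once its rational witness `e` is named; it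
-- lets a bound by a rational replace a bound by the real `y`.
<fromℚ⇒< : ∀ {x y d e} → d ℚ.≤ e → ∃[ N ] (∀ n → N ℕ.≤ n → 0ℚ ℚ.+ e ℚ.≤ seq y n) →
  x < fromℚ d → x < y
<fromℚ⇒< {x} {y} {d} {e} d≤e (M , hM) (δ , δ>0 , N , hN) = δ , δ>0 , M ⊔ N , λ n n≥ → begin
  seq x n ℚ.+ δ ≤⟨ hN n (ℕ.m⊔n≤o⇒n≤o M N n≥) ⟩
  d             ≤⟨ d≤e ⟩
  e             ≡⟨ ℚ.+-identityˡ e ⟨
  0ℚ ℚ.+ e      ≤⟨ hM n (ℕ.m⊔n≤o⇒m≤o M N n≥) ⟩
  seq y n       ∎
  where open ℚ.≤-Reasoning

0<⊓ : ∀ {d e} → 0ℚ ℚ.< d → 0ℚ ℚ.< e → 0ℚ ℚ.< d ℚ.⊓ e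
0<⊓ {d} {e} d>0 e>0 with ℚ.⊓-sel d e
... | inj₁ eq = subst (0ℚ ℚ.<_) (sym eq) d>0
... | inj₂ eq = subst (0ℚ ℚ.<_) (sym eq) e>0

-- The minimum is taken not of the real radii but of the rationals `d` and `e` that witness their
-- positivity.
Near1-× : ∀ {A B} → Near1 A → Near1 B → Near1 (λ p → A p × B p)
Near1-× (δ , (d , d>0 , hd) , a) (ε , (e , e>0 , he) , b) =
  fromℚ (d ℚ.⊓ e) , 0<fromℚ (0<⊓ d>0 e>0) , λ p p>0 p<1 close →
    a p p>0 p<1 (<fromℚ⇒< {1ℝ - p} {δ} (ℚ.p⊓q≤p d e) hd close) ,
    b p p>0 p<1 (<fromℚ⇒< {1ℝ - p} {ε} (ℚ.p⊓q≤q d e) he close)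

Near1⇒∃ : ∀ {A} → Near1 A → ∃[ p ] A p
Near1⇒∃ (δ , (d , d>0 , N , hd) , a) = fromℚ (1ℚ ℚ.- t) , a (fromℚ (1ℚ ℚ.- t))
  (½ , ℚ.positive⁻¹ ½ , 0 , λ _ _ → ½≤1-x t≤½)
  (t , t>0 , 0 , λ _ _ → ℚ.≤-reflexive (x-y+y≡x 1ℚ t))
  (t , t>0 , N , λ n n≥ → begin
    1ℚ ℚ.- (1ℚ ℚ.- t) ℚ.+ t   ≡⟨ 1-[1-½x]+½x≡x (d ℚ.⊓ 1ℚ) ⟩
    d ℚ.⊓ 1ℚ                  ≤⟨ ℚ.p⊓q≤p d 1ℚ ⟩
    d                         ≡⟨ ℚ.+-identityˡ d ⟨
    0ℚ ℚ.+ d                  ≤⟨ hd n n≥ ⟩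
    seq δ n                   ∎)
  where
  open ℚ.≤-Reasoning
  t : ℚ
  -- Capping at 1 gives `t` at most ½, which keeps `1 - t` positive; halving leaves a second `t` as
  -- the slack that the strict bound by `δ` demands.
  t = ½ ℚ.* (d ℚ.⊓ 1ℚ)
  t>0 : 0ℚ ℚ.< t
  t>0 = 0<½x (0<⊓ d>0 (ℚ.positive⁻¹ 1ℚ))
  t≤½ : t ℚ.≤ ½
  t≤½ = ℚ.*-monoˡ-≤-nonNeg ½ (ℚ.p⊓q≤q d 1ℚ)

-- Both approximations hold at some common `p`, and two errors of half of `δ` add up to the slack
-- allowed by `≤`. Exchanging the two limits gives the other inequality.
⟶-unique : ∀ {f a b} → f ⟶ a → f ⟶ b → a ≤ b
⟶-unique {f} {a} {b} f⟶a f⟶b δ δ>0 =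
  let p , (_ , α>0 , M , ha) , (_ , β>0 , N , hb) =
        Near1⇒∃ (Near1-× (f⟶a h (0<fromℚ (0<½x δ>0))) (f⟶b h (0<fromℚ (0<½x δ>0))))
  in M ⊔ N , λ n n≥ →
    midpoint-≤ (seq a n) (seq b n) (seq (f p) n) δ
      (x+y≤z⇒x≤z α>0 (ha n (ℕ.m⊔n≤o⇒m≤o M N n≥)))
      (x+y≤z⇒x≤z β>0 (hb n (ℕ.m⊔n≤o⇒n≤o M N n≥)))
  where
  h : ℝ
  h = fromℚ (½ ℚ.* δ)

-- A single bucket

-- `x` will be `1ℝ - p`. The bounds are assumed at one index `j` because the representative of a
-- real strictly between 0 and 1 is guaranteed to satisfy them only from some index on.
module _ (x : ℝ) (j : ℕ) (0≤x : 0ℚ ℚ.≤ seq x j) (x≤1 : seq x j ℚ.≤ 1ℚ) where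

  private
    instance
      x≥0 : ℚ.NonNegative (seq x j)
      x≥0 = ℚ.nonNegative 0≤x

  0≤x^c : ∀ c → 0ℚ ℚ.≤ seq (x ^ c) j
  0≤x^c zero    = ℚ.nonNegative⁻¹ 1ℚ
  0≤x^c (suc c) = subst (ℚ._≤ seq (x ^ suc c) j) (ℚ.*-zeroʳ (seq x j))
    (ℚ.*-monoˡ-≤-nonNeg (seq x j) (0≤x^c c))

  -- Mutual induction: the bound by 1 at `c` gives the bound by `x` at `suc c`, which in turn gives
  -- the bound by 1 there.
  x^c≤1 : ∀ c → seq (x ^ c) j ℚ.≤ 1ℚ
  x^[1+c]≤x : ∀ c → seq (x ^ suc c) j ℚ.≤ seq x j

  x^c≤1 zero    = ℚ.≤-refl
  x^c≤1 (suc c) = ℚ.≤-trans (x^[1+c]≤x c) x≤1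

  x^[1+c]≤x c = subst (seq (x ^ suc c) j ℚ.≤_) (ℚ.*-identityʳ (seq x j))
    (ℚ.*-monoˡ-≤-nonNeg (seq x j) (x^c≤1 c))

  1≤c⇒x^c≤x : ∀ {c} → 1 ℕ.≤ c → seq (x ^ c) j ℚ.≤ seq x j
  1≤c⇒x^c≤x {suc c} _ = x^[1+c]≤x c

  1-x^card≤indicator : ∀ {n} (s : Subset n) →
    seq (1ℝ - x ^ card s) j ℚ.≤ indicator (does (nonempty? s))
  1-x^card≤indicator {n} s with nonempty? s
  ... | yes _ = x-y≤x 1ℚ (0≤x^c (card s))
  -- The rewriting turns the exponent into 0, and `x ^ 0` is 1, so the left side computes to 0.
  ... | no ∅  rewrite Empty-unique ∅ | ∣⊥∣≡0 n = ℚ.≤-refl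

  -- A nonempty set has a positive exponent, and then the power is at most `x`. The factor `1ℚ` is
  -- the weight expected by `sum-mono-≤-error`.
  indicator≤1-x^card+x : ∀ {n} (s : Subset n) →
    indicator (does (nonempty? s)) ℚ.≤ seq (1ℝ - x ^ card s) j ℚ.+ 1ℚ ℚ.* seq x j
  indicator≤1-x^card+x {n} s with nonempty? s
  ... | yes s≢∅ = begin
    1ℚ                                               ≡⟨ x-y+y≡x 1ℚ (seq (x ^ card s) j) ⟨
    seq (1ℝ - x ^ card s) j ℚ.+ seq (x ^ card s) j   ≤⟨ ℚ.+-monoʳ-≤ (seq (1ℝ - x ^ card s) j) (1≤c⇒x^c≤x (nonempty⇒1≤card s≢∅)) ⟩
    seq (1ℝ - x ^ card s) j ℚ.+ seq x j              ≡⟨ cong (seq (1ℝ - x ^ card s) j ℚ.+_) (ℚ.*-identityˡ (seq x j)) ⟨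
    seq (1ℝ - x ^ card s) j ℚ.+ 1ℚ ℚ.* seq x j       ∎
    where open ℚ.≤-Reasoning
  ... | no ∅ rewrite Empty-unique ∅ | ∣⊥∣≡0 n =
    ℚ.+-mono-≤ (ℚ.≤-refl {0ℚ}) (subst (0ℚ ℚ.≤_) (sym (ℚ.*-identityˡ (seq x j))) 0≤x)

-- Comparison of the objectives

module _ {m n k : ℕ} .{{_ : NonZero m}} (G : BipartiteGraph m n) where

  private
    1/m : ℚ
    1/m = + 1 ℚ./ m

    instance
      1/m>0 : ℚ.Positive 1/m
      1/m>0 = ℚ.normalize-pos 1 m
      1/m≥0 : ℚ.NonNegative 1/m
      1/m≥0 = ℚ.pos⇒nonNeg 1/m

    -- This is k; only its finiteness matters.
    maxError : ℚ
    maxError = 1/m ℚ.* sum {m} (λ _ → sum {k} (λ _ → 1ℚ))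

    0≤maxError : 0ℚ ℚ.≤ maxError
    0≤maxError = subst (ℚ._≤ maxError) (ℚ.*-zeroʳ 1/m)
      (ℚ.*-monoˡ-≤-nonNeg 1/m (0≤sum {m} λ _ → 0≤sum {k} λ _ → ℚ.nonNegative⁻¹ 1ℚ))

  seq-average : (f : Fin m → ℝ) → ∀ j →
    seq (average f) j ≡ 1/m ℚ.* sum (λ q → seq (f q) j)
  seq-average f j = cong (1/m ℚ.*_) (seq-∑ f j)

  module _ (P : Partitioning n k) (p : ℝ) (j : ℕ)
           (0≤1-p : 0ℚ ℚ.≤ seq (1ℝ - p) j) (1-p≤1 : seq (1ℝ - p) j ℚ.≤ 1ℚ) where

    private
      pcontribution : Fin m → Fin k → ℝ
      pcontribution q i = 1ℝ - (1ℝ - p) ^ neighboursIn G P i q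

      meets : Fin m → Fin k → Bool
      meets q i = does (nonempty? (G q ∩ bucket P i))

    queryPFanout≤queryFanout : ∀ q → seq (queryPFanout G p P q) j ℚ.≤ ι (queryFanout G P q)
    queryPFanout≤queryFanout q = subst₂ ℚ._≤_
      (sym (seq-∑ (pcontribution q) j)) (sym (ι-card-tabulate (meets q)))
      (sum-mono-≤ λ i → 1-x^card≤indicator (1ℝ - p) j 0≤1-p 1-p≤1 (G q ∩ bucket P i))

    queryFanout≤queryPFanout+error : ∀ q → ι (queryFanout G P q) ℚ.≤
      seq (queryPFanout G p P q) j ℚ.+ sum {k} (λ _ → 1ℚ) ℚ.* seq (1ℝ - p) j
    queryFanout≤queryPFanout+error q = subst₂ ℚ._≤_
      (sym (ι-card-tabulate (meets q)))
      (cong (ℚ._+ sum {k} (λ _ → 1ℚ) ℚ.* seq (1ℝ - p) j) (sym (seq-∑ (pcontribution q) j)))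
      (sum-mono-≤-error λ i →
        indicator≤1-x^card+x (1ℝ - p) j 0≤1-p 1-p≤1 (G q ∩ bucket P i))

    pfanout≤fanout : seq (pfanout G p P) j ℚ.≤ seq (fanout G P) j
    pfanout≤fanout = subst₂ ℚ._≤_
      (sym (seq-average (queryPFanout G p P) j)) (sym (seq-average (fromℕ ∘ queryFanout G P) j))
      (ℚ.*-monoˡ-≤-nonNeg 1/m (sum-mono-≤ queryPFanout≤queryFanout))

    fanout≤pfanout+error : seq (fanout G P) j ℚ.≤
      seq (pfanout G p P) j ℚ.+ maxError ℚ.* seq (1ℝ - p) j
    fanout≤pfanout+error = begin
      seq (fanout G P) j                                ≡⟨ seq-average (fromℕ ∘ queryFanout G P) j ⟩
      1/m ℚ.* sum (ι ∘ queryFanout G P)                 ≤⟨ ℚ.*-monoˡ-≤-nonNeg 1/m (sum-mono-≤-error queryFanout≤queryPFanout+error) ⟩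
      1/m ℚ.* (s ℚ.+ t ℚ.* r)                           ≡⟨ w*[x+y*z]≡w*x+w*y*z 1/m s t r ⟩
      1/m ℚ.* s ℚ.+ maxError ℚ.* r                      ≡⟨ cong (ℚ._+ maxError ℚ.* r) (seq-average (queryPFanout G p P) j) ⟨
      seq (pfanout G p P) j ℚ.+ maxError ℚ.* r          ∎
      where
      open ℚ.≤-Reasoning
      r s t : ℚ
      r = seq (1ℝ - p) j
      s = sum (λ q → seq (queryPFanout G p P q) j)
      t = sum {m} (λ _ → sum {k} (λ _ → 1ℚ))

  -- Rational bounds from some index on are sharper than `≤` on `ℝ`, which would add a slack of its
  -- own to each side. The lower side carries no error at all.
  Within : ℚ → ℝ → Partitioning n k → Set
  Within η p P = ∃[ N ] (∀ j → N ℕ.≤ j →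
    seq (pfanout G p P) j ℚ.≤ seq (fanout G P) j ×
    seq (fanout G P) j ℚ.≤ seq (pfanout G p P) j ℚ.+ η)

  -- The error is at most `maxError` times `1 - p`, and `maxError` does not mention the
  -- partitioning; hence the radius is fixed before `P`.
  pfanout-uniformly-near-fanout : ∀ {η} → 0ℚ ℚ.< η → Near1 (λ p → ∀ P → Within η p P)
  pfanout-uniformly-near-fanout {η} η>0 = fromℚ d , 0<fromℚ d>0 ,
    λ { p (α , α>0 , K , hα) (_ , β>0 , L , hβ) (_ , γ>0 , M , hγ) P →
      K ⊔ (L ⊔ M) , λ j j≥ →
      let j≥L⊔M = ℕ.m⊔n≤o⇒n≤o K (L ⊔ M) j≥
          0≤p   = ℚ.≤-trans {j = 0ℚ ℚ.+ α} (subst (0ℚ ℚ.≤_) (sym (ℚ.+-identityˡ α)) (ℚ.<⇒≤ α>0))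
                    (hα j (ℕ.m⊔n≤o⇒m≤o K (L ⊔ M) j≥))
          0≤1-p = x≤y⇒0≤y-x {seq p j} {1ℚ} (x+y≤z⇒x≤z β>0 (hβ j (ℕ.m⊔n≤o⇒m≤o L M j≥L⊔M)))
          1-p≤1 = x-y≤x 1ℚ {seq p j} 0≤p
          1-p≤d = x+y≤z⇒x≤z {1ℚ ℚ.- seq p j} γ>0 (hγ j (ℕ.m⊔n≤o⇒n≤o L M j≥L⊔M))
      in pfanout≤fanout P p j 0≤1-p 1-p≤1 ,
         ℚ.≤-trans (fanout≤pfanout+error P p j 0≤1-p 1-p≤1)
           (ℚ.+-monoʳ-≤ (seq (pfanout G p P) j)
             (ℚ.≤-trans (ℚ.*-monoˡ-≤-nonNeg maxError 1-p≤d) maxError*d≤η)) }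
    where
    B : ℚ
    -- Adding 1 makes the divisor positive even when `k` is 0 and `maxError` vanishes.
    B = 1ℚ ℚ.+ maxError
    B>0 : 0ℚ ℚ.< B
    B>0 = ℚ.+-mono-<-≤ (ℚ.positive⁻¹ 1ℚ) 0≤maxError
    instance
      _ = ℚ.nonNegative 0≤maxError
      B⁺ : ℚ.Positive B
      B⁺ = ℚ.positive B>0
      η⁺ : ℚ.Positive η
      η⁺ = ℚ.positive η>0
      B≢0 : ℚ.NonZero B
      B≢0 = ℚ.pos⇒nonZero B
    d : ℚ
    d = (ℚ.1/ B) ℚ.* η
    d>0 : 0ℚ ℚ.< d
    d>0 = ℚ.positive⁻¹ d {{ℚ.pos*pos⇒pos (ℚ.1/ B) {{ℚ.1/pos⇒pos B}} η}}
    maxError*d≤η : maxError ℚ.* d ℚ.≤ η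
    maxError*d≤η = begin
      maxError ℚ.* d            ≤⟨ x≤x+y _ (ℚ.<⇒≤ d>0) ⟩
      maxError ℚ.* d ℚ.+ d      ≡⟨ x*y+y≡[1+x]*y maxError d ⟩
      B ℚ.* (ℚ.1/ B ℚ.* η)      ≡⟨ ℚ.*-assoc B (ℚ.1/ B) η ⟨
      B ℚ.* ℚ.1/ B ℚ.* η        ≡⟨ cong (ℚ._* η) (ℚ.*-inverseʳ B) ⟩
      1ℚ ℚ.* η                  ≡⟨ ℚ.*-identityˡ η ⟩
      η                         ∎
      where open ℚ.≤-Reasoning

  pfanout⟶fanout : ∀ P → (λ p → pfanout G p P) ⟶ fanout G P
  pfanout⟶fanout P e (d , d>0 , M , he)
    = let δ , δ>0 , near = pfanout-uniformly-near-fanout (0<½x d>0) in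
      δ , δ>0 , λ p p>0 p<1 close → let N , h = near p p>0 p<1 close P in
      -- Eventually `e` is at least `d`: one half of `d` is the slack witnessing `<`, the other half
      -- bounds the error.
      ½ ℚ.* d , 0<½x d>0 , M ⊔ N , λ j j≥ →
      let below , above = h j (ℕ.m⊔n≤o⇒n≤o M N j≥) in begin
      ℚ.∣ seq (pfanout G p P) j ℚ.- seq (fanout G P) j ∣ ℚ.+ ½ ℚ.* d
        ≤⟨ ℚ.+-monoˡ-≤ (½ ℚ.* d) (x≤y≤x+z⇒∣x-y∣≤z below above) ⟩
      ½ ℚ.* d ℚ.+ ½ ℚ.* d
        ≡⟨ ½x+½x≡0+x d ⟩
      0ℚ ℚ.+ d
        ≤⟨ he j (ℕ.m⊔n≤o⇒m≤o M N j≥) ⟩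
      seq e j ∎
    where open ℚ.≤-Reasoning

  -- Discreteness of the fanout

  seq-fanout : ∀ (P : Partitioning n k) j →
    seq (fanout G P) j ≡ 1/m ℚ.* ι (sumℕ (queryFanout G P))
  seq-fanout P j = trans (seq-average (fromℕ ∘ queryFanout G P) j)
    (cong (1/m ℚ.*_) (sym (ι-sum (queryFanout G P))))

  -- Order on `ℝ` is not decidable in general, but fanouts are integer totals scaled by `1/m`.
  -- Comparing the totals decides the case, and a strict inequality of integers is a difference of
  -- at least one.
  fanout-gap : ∀ (P P′ : Partitioning n k) →
    (∀ j → seq (fanout G P) j ℚ.≤ seq (fanout G P′) j) ⊎
    (∀ j → 1/m ℚ.+ seq (fanout G P′) j ℚ.≤ seq (fanout G P) j)
  fanout-gap P P′ = Sum.map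
    (λ h j → subst₂ ℚ._≤_ (sym (seq-fanout P j)) (sym (seq-fanout P′ j))
      (ℚ.*-monoˡ-≤-nonNeg 1/m (ι-mono-≤ h)))
    (λ h j → subst₂ ℚ._≤_
      (trans (scaled-suc 1/m (total P′)) (cong (1/m ℚ.+_) (sym (seq-fanout P′ j))))
      (sym (seq-fanout P j))
      (ℚ.*-monoˡ-≤-nonNeg 1/m (ι-mono-≤ h)))
    (ℕ.≤-<-connex (total P) (total P′))
    where
    total : Partitioning n k → ℕ
    total P = sumℕ (queryFanout G P)
    scaled-suc : ∀ x a → x ℚ.* ι (suc a) ≡ x ℚ.+ x ℚ.* ι a
    scaled-suc x a = trans (cong (x ℚ.*_) (ι-+ 1 a)) (sym (x+x*y≡x*[1+y] x (ι a)))

  pfanout≤⇒fanout≤ : Near1 (λ p → ∀ P P′ → pfanout G p P ≤ pfanout G p P′ → fanout G P ≤ fanout G P′)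
  pfanout≤⇒fanout≤ =
    let δ , δ>0 , near = pfanout-uniformly-near-fanout η>0 in
    δ , δ>0 , λ p p>0 p<1 close P P′ P≤P′ → fanout≤ p P P′ P≤P′
        (near p p>0 p<1 close P) (near p p>0 p<1 close P′) (fanout-gap P P′)
    where
    η : ℚ
    -- `η` is spent twice: on the passage from fanout to pfanout for `P`, and on the slack in
    -- `P≤P′`. The return to fanout for `P′` is free, so the total is half of `1/m`.
    η = ½ ℚ.* (½ ℚ.* 1/m)
    η>0 : 0ℚ ℚ.< η
    η>0 = 0<½x (0<½x (ℚ.positive⁻¹ 1/m))
    fanout≤ : ∀ p P P′ → pfanout G p P ≤ pfanout G p P′ → Within η p P → Within η p P′ →
      (∀ j → seq (fanout G P) j ℚ.≤ seq (fanout G P′) j) ⊎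
      (∀ j → 1/m ℚ.+ seq (fanout G P′) j ℚ.≤ seq (fanout G P) j) →
      fanout G P ≤ fanout G P′
    fanout≤ p P P′ _ _ _ (inj₁ F≤F′) δ δ>0 = 0 , λ j _ →
      ℚ.≤-trans (F≤F′ j) (x≤x+y _ (ℚ.<⇒≤ δ>0))
    fanout≤ p P P′ P≤P′ (K , h) (L , h′) (inj₂ gap) =
      let M , hM = P≤P′ η η>0
          -- A single index at which all three eventual bounds hold already yields the
          -- contradiction.
          j      = K ⊔ (L ⊔ M)
          j≥L⊔M  = ℕ.m≤n⊔m K (L ⊔ M)
      in ⊥-elim (gap-too-wide (ℚ.positive⁻¹ 1/m)
           (gap j)
           (proj₂ (h j (ℕ.m≤m⊔n K (L ⊔ M))))
           (hM j (ℕ.m⊔n≤o⇒n≤o L M j≥L⊔M))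
           (proj₁ (h′ j (ℕ.m⊔n≤o⇒m≤o L M j≥L⊔M))))

-- Transfer to minimizers

Minimizes-resp : ∀ {n k} .{{_ : NonTrivial k}} {ε} {f g : Partitioning n k → ℝ} →
  (∀ P → f P ≤ g P) → (∀ P → g P ≤ f P) →
  ∀ P → Minimizes ε f P → Minimizes ε g P
Minimizes-resp {f = f} {g} f≤g g≤f P (balanced , min) = balanced , λ P′ balanced′ →
  ≤-trans {g P} {f P} {g P′} (g≤f P) (≤-trans {f P} {f P′} {g P′} (min P′ balanced′) (f≤g P′))

lemma1 : (m n : ℕ) .{{_ : NonZero m}} (G : BipartiteGraph m n)
    (k : ℕ) .{{_ : NonTrivial k}} (ε : ℝ) → 0ℝ ≤ ε →
    ((P : Partitioning n k) → (λ p → pfanout G p P) ⟶ fanout G P)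
    × ((L : Partitioning n k → ℝ) →
    ((P : Partitioning n k) → (λ p → pfanout G p P) ⟶ L P) →
    (P : Partitioning n k) → Minimizes ε L P ⇔ Minimizes ε (fanout G) P)
    × Near1 (λ p → (P : Partitioning n k) →
    Minimizes ε (pfanout G p) P → Minimizes ε (fanout G) P)
lemma1 m n G k ε _ = pfanout⟶fanout G , limit , near
  where
  limit : (L : Partitioning n k → ℝ) →
    ((P : Partitioning n k) → (λ p → pfanout G p P) ⟶ L P) →
    (P : Partitioning n k) → Minimizes ε L P ⇔ Minimizes ε (fanout G) P
  -- By uniqueness of limits, `L` and the fanout bound each other at every partitioning, so each
  -- inherits the minimizers of the other.
  limit L ⟶L P = mk⇔
    (Minimizes-resp {ε = ε} {L} {fanout G} L≤fanout fanout≤L P)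
    (Minimizes-resp {ε = ε} {fanout G} {L} fanout≤L L≤fanout P)
    where
    L≤fanout : ∀ P → L P ≤ fanout G P
    L≤fanout P = ⟶-unique {λ p → pfanout G p P} {L P} {fanout G P} (⟶L P) (pfanout⟶fanout G P)
    fanout≤L : ∀ P → fanout G P ≤ L P
    fanout≤L P = ⟶-unique {λ p → pfanout G p P} {fanout G P} {L P} (pfanout⟶fanout G P) (⟶L P)
  near : Near1 (λ p → (P : Partitioning n k) →
    Minimizes ε (pfanout G p) P → Minimizes ε (fanout G) P)
  -- One radius serves every `P` and every competitor `P′`, since the comparison of objectives is
  -- uniform in both; balance is independent of the objective.
  near = let δ , δ>0 , h = pfanout≤⇒fanout≤ G in
    δ , δ>0 , λ { p p>0 p<1 close P (balanced , min) → balanced , λ P′ balanced′ →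
        h p p>0 p<1 close P P′ (min P′ balanced′) }
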